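{- Let $\Gamma$ be a non-Abelian group of order $n$, let $S\subseteq\Gamma$ with $|S|=s$, and let $m\ge1$ be an integer. Then $G_m(S)=(V_0\cup V_1,E)$ is a bipartite graph with $(m+1)n$ vertices, where every vertex in $V_0$ has degree $ms$ and every vertex in $V_1$ has degree $s$. Moreover, the diameter of $G_m(S)$ is $3$ if both $S$ and $\overline{S}=\{t^{ -1}: t\in S\}$ are covering difference sets of $\Gamma$.
   Context: Let $\Gamma$ be a finite group (written multiplicatively) and $S\subseteq\Gamma$. $S$ is a covering difference set (covering set) of $\Gamma$ if the multiset of differences $\{t\cdot t'^{ -1} : t,t'\in S\}$ contains all the elements of $\Gamma$ (perhaps with some repetitions). For an integer $m\ge1$, $G_m(S)=(V_0\cup V_1,E)$ is the bipartite graph with independent sets $V_0=\{(0,u):u\in\Gamma\}$ and $V_1=\{(l,v): v\in\Gamma,\ 1\le l\le m\}$, and adjacencies $(l,v)\sim(0,v\cdot\sigma)$ for all $\sigma\in S$, $v\in\Gamma$ and $l\in\{1,\dots,m\}$.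
   Formalization: The diameter claim is stated for S ≠ Γ: when S = Γ, both S and its inverse set are covering difference sets, but G_m(S) is a complete bipartite graph of diameter 2, so the claim as printed fails there. -}

module Defs where

open import Algebra.Bundles using (Group)
open import Data.Fin.Base using (Fin; zero; suc)
open import Data.Nat.Base using (ℕ; zero; suc; _≤_)
open import Data.Product.Base using (∃-syntax; _×_; _,_; proj₁)
open import Data.Product.Relation.Binary.Pointwise.NonDependent using (×-setoid)
open import Data.Sum.Base using (_⊎_)
open import Function.Bundles using (Inverse)
open import Level using (Level; _⊔_) renaming (suc to lsuc)
open import Relation.Binary.Bundles using (Setoid)
open import Relation.Binary.Construct.Closure.Symmetric using (SymClosure; fwd; bwd; symmetric)
open import Relation.Binary.Core using (Rel)
open import Relation.Binary.Definitions using (Symmetric; _Respects₂_)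
import Relation.Binary.Construct.On as On
open import Relation.Binary.PropositionalEquality.Core using (_≡_; refl)
import Relation.Binary.PropositionalEquality.Properties as ≡
open import Relation.Nullary.Negation.Core using (¬_)
open import Relation.Unary using (Pred; _∈_)

HasCardinality : ∀ {a ℓ} → Setoid a ℓ → ℕ → Set (a ⊔ ℓ)
HasCardinality A n = Inverse (≡.setoid (Fin n)) A

-- Elements are compared by their underlying element of A only, so the
-- cardinality of this setoid is that of the subset P, however many membership
-- proofs an element may have.
subsetoid : ∀ {a ℓ p} (A : Setoid a ℓ) → Pred (Setoid.Carrier A) p → Setoid (a ⊔ p) ℓ
subsetoid A P = On.setoid A (proj₁ {B = P})

record Graph (a ℓ e : Level) : Set (lsuc (a ⊔ ℓ ⊔ e)) where
  field
    vertices : Setoid a ℓ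
  open Setoid vertices public using () renaming (Carrier to Vertex; _≈_ to _≈ᵥ_)
  field
    Adj      : Rel Vertex e
    adj-resp : Adj Respects₂ _≈ᵥ_
    adj-sym  : Symmetric Adj
    loopless : ∀ {x y} → x ≈ᵥ y → ¬ Adj x y

module _ {a ℓ e} (G : Graph a ℓ e) where
  open Graph G

  Independent : ∀ {p} → Pred Vertex p → Set (a ⊔ e ⊔ p)
  Independent A = ∀ {x y} → x ∈ A → y ∈ A → ¬ Adj x y

  record IsBipartite {p q} (A : Pred Vertex p) (B : Pred Vertex q) : Set (a ⊔ e ⊔ p ⊔ q) where
    field
      cover        : ∀ x → x ∈ A ⊎ x ∈ B
      disjoint     : ∀ {x} → x ∈ A → ¬ (x ∈ B)
      independentˡ : Independent A
      independentʳ : Independent B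

  HasDegree : Vertex → ℕ → Set (a ⊔ ℓ ⊔ e)
  HasDegree x d = HasCardinality (subsetoid vertices (Adj x)) d

  data Walk : ℕ → Vertex → Vertex → Set (a ⊔ ℓ ⊔ e) where
    stop : ∀ {x y} → x ≈ᵥ y → Walk zero x y
    step : ∀ {k x y z} → Adj x y → Walk k y z → Walk (suc k) x z

  HasDistance : Vertex → Vertex → ℕ → Set (a ⊔ ℓ ⊔ e)
  HasDistance x y d = Walk d x y × (∀ k → Walk k x y → d ≤ k)

  -- The diameter is the maximum of all distances; in particular every pair of
  -- vertices is at a finite distance.
  HasDiameter : ℕ → Set (a ⊔ ℓ ⊔ e)
  HasDiameter D = (∀ x y → ∃[ d ] (HasDistance x y d × d ≤ D))
                × (∃[ x ] ∃[ y ] HasDistance x y D)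

module _ {c ℓ} (Γ : Group c ℓ) where
  open Group Γ

  NonAbelian : Set (c ⊔ ℓ)
  NonAbelian = ¬ (∀ x y → x ∙ y ≈ y ∙ x)

  Covering : ∀ {p} → Pred Carrier p → Set (c ⊔ ℓ ⊔ p)
  Covering S = ∀ g → ∃[ t ] ∃[ t′ ] (t ∈ S × t′ ∈ S × g ≈ t ∙ t′ ⁻¹)

  Inverses : ∀ {p} → Pred Carrier p → Pred Carrier (c ⊔ ℓ ⊔ p)
  Inverses S x = ∃[ t ] (t ∈ S × x ≈ t ⁻¹)

  module _ (m : ℕ) where

    -- (zero , u) is the vertex (0,u), and (suc i , v) with i : Fin m is the
    -- vertex (l,v) with l = toℕ i + 1, so that l ranges over 1, …, m.
    layers : Setoid c ℓ
    layers = ×-setoid (≡.setoid (Fin (suc m))) setoid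

    V₀ : Pred (Setoid.Carrier layers) _
    V₀ (l , _) = l ≡ zero

    V₁ : Pred (Setoid.Carrier layers) _
    V₁ (l , _) = ∃[ i ] l ≡ suc i

    data Edge {p} (S : Pred Carrier p) : Rel (Setoid.Carrier layers) (c ⊔ ℓ ⊔ p) where
      edge : ∀ {i v u σ} → σ ∈ S → u ≈ v ∙ σ → Edge S (suc i , v) (zero , u)

    G : ∀ {p} → Pred Carrier p → Graph c ℓ (c ⊔ ℓ ⊔ p)
    G S = record
      { vertices = layers
      ; Adj      = SymClosure (Edge S)
      ; adj-resp = respʳ , λ x≈y x~z → symmetric (Edge S) (respʳ x≈y (symmetric (Edge S) x~z))
      ; adj-sym  = symmetric (Edge S)
      ; loopless = λ { (() , _) (fwd (edge _ _)) ; (() , _) (bwd (edge _ _)) }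
      }
      where
      open Setoid layers using () renaming (_≈_ to _≈ᵥ_)
      respʳ : ∀ {x y z} → y ≈ᵥ z → SymClosure (Edge S) x y → SymClosure (Edge S) x z
      respʳ (refl , u≈) (fwd (edge σ∈S u≈vσ)) = fwd (edge σ∈S (trans (sym u≈) u≈vσ))
      respʳ (refl , v≈) (bwd (edge σ∈S u≈vσ)) = bwd (edge σ∈S (trans u≈vσ (∙-congʳ v≈)))

{-# OPTIONS --safe #-}

-- By translation, two vertices (0,u) and (0,u′) have a common neighbour exactly
-- when u⁻¹u′ = σ⁻¹σ′ for some σ, σ′ ∈ S, and two vertices (l,v) and (l′,v′)
-- exactly when v⁻¹v′ = σσ′⁻¹.  The two covering conditions therefore join any two
-- vertices on the same side by a walk of length 2, and any two vertices on
-- opposite sides by one of length 3.  An element g ∉ S makes (1,ε) and (0,g)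
-- non-adjacent, and parity then puts them at distance 3.
module Submission where

open import Defs
open import Algebra.Bundles using (Group)
import Algebra.Properties.Group as GroupProperties
open import Data.Fin.Base using (Fin; zero; suc)
open import Data.Fin.Properties as Fin using (any?; inj⇒≟; ¬∀⟶∃¬; *↔×)
open import Data.Nat.Base using (ℕ; zero; suc; _+_; _*_; _≤_; z≤n; s≤s)
open import Data.Nat.Properties using (+-comm; ≤-refl; m≤n⇒m≤1+n)
open import Data.Product.Base using (∃-syntax; _×_; _,_; proj₁; proj₂)
open import Data.Product.Function.NonDependent.Setoid using (_×-inverse_)
open import Data.Product.Relation.Binary.Pointwise.NonDependent
  using (×-setoid; ×-decidable; Pointwise-≡↔≡)
open import Data.Sum.Base using (inj₁; inj₂)
open import Function.Base using (_∘_)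
open import Function.Bundles using (Inverse)
import Function.Construct.Composition as Composition
import Function.Construct.Identity as Identity
import Function.Construct.Symmetry as Symmetry
open import Function.Properties.Inverse using (Inverse⇒Injection)
open import Relation.Binary.Bundles using (Setoid)
open import Relation.Binary.Construct.Closure.Symmetric using (fwd; bwd)
open import Relation.Binary.Definitions using (Decidable; _Respects_)
open import Relation.Binary.PropositionalEquality.Core using (refl; subst)
import Relation.Binary.PropositionalEquality.Properties as ≡
import Relation.Binary.Reasoning.Setoid as SetoidReasoning
open import Relation.Nullary.Decidable.Core using (yes; no; map′)
open import Relation.Nullary.Negation.Core using (¬_; contradiction)
open import Relation.Unary using (Pred; _∈_; _∉_; Universal)
import Relation.Unary as Unary

-- Finite setoids: products, decidability and witnesses.

module _ {a ℓ} {A : Setoid a ℓ} where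
  open Setoid A

  finite⇒≟ : ∀ {n} → HasCardinality A n → Decidable _≈_
  finite⇒≟ card = inj⇒≟ (Inverse⇒Injection (Symmetry.inverse card))

  ×-cardinality : ∀ {b ℓ′ m n} {B : Setoid b ℓ′} → HasCardinality A m → HasCardinality B n →
                  HasCardinality (×-setoid A B) (m * n)
  ×-cardinality cardA cardB = Composition.inverse *↔×
    (Composition.inverse (Symmetry.inverse Pointwise-≡↔≡) (cardA ×-inverse cardB))

  module _ {p} {P : Pred Carrier p} (P-resp : P Respects _≈_) where

    -- The enumeration of the subset is searched for an entry equal to `x`; since `P` respects
    -- equality, a hit carries its membership proof over to `x`.
    finite-subset⇒decidable : ∀ {n} → Decidable _≈_ → HasCardinality (subsetoid A P) n →
                              Unary.Decidable P
    finite-subset⇒decidable _≟_ card x = map′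
      (λ (i , eq) → P-resp eq (proj₂ (to i)))
      (λ x∈P → from (x , x∈P) , strictlyInverseˡ (x , x∈P))
      (any? (λ i → proj₁ (to i) ≟ x))
      where open Inverse card

    -- Constructively a failed universal need not give a witness; here a finite search over the
    -- indices finds one. It supplies the far end of a pair at distance 3.
    ¬universal⇒∃∉ : ∀ {n} → HasCardinality A n → Unary.Decidable P → ¬ Universal P →
                    ∃[ x ] x ∉ P
    ¬universal⇒∃∉ {n} card P? ¬all = to (proj₁ counterexample) , proj₂ counterexample
      where
      open Inverse card
      counterexample : ∃[ i ] to i ∉ P
      counterexample = ¬∀⟶∃¬ n (P ∘ to) (P? ∘ to)
        (λ all → ¬all (λ x → P-resp (strictlyInverseˡ x) (all (from x))))

-- Lower bounds on walks and exact distances in a graph.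

module _ {a ℓ e} (𝒢 : Graph a ℓ e) where
  open Graph 𝒢

  1≤walk : ∀ {k x y} → ¬ x ≈ᵥ y → Walk 𝒢 k x y → 1 ≤ k
  1≤walk x≉y (stop x≈y) = contradiction x≈y x≉y
  1≤walk x≉y (step _ _) = s≤s z≤n

  2≤walk : ∀ {k x y} → ¬ x ≈ᵥ y → ¬ Adj x y → Walk 𝒢 k x y → 2 ≤ k
  2≤walk x≉y x≁y (stop x≈y)              = contradiction x≈y x≉y
  2≤walk x≉y x≁y (step x~z (stop z≈y))   = contradiction (proj₁ adj-resp z≈y x~z) x≁y
  2≤walk x≉y x≁y (step _ (step _ _))     = s≤s (s≤s z≤n)

  3≤walk : ∀ {k x y} → ¬ x ≈ᵥ y → ¬ Adj x y → ¬ Walk 𝒢 2 x y → Walk 𝒢 k x y → 3 ≤ k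
  3≤walk {0} x≉y x≁y ¬w₂ w with () ← 2≤walk x≉y x≁y w
  3≤walk {1} x≉y x≁y ¬w₂ w with s≤s () ← 2≤walk x≉y x≁y w
  3≤walk {2} x≉y x≁y ¬w₂ w = contradiction w ¬w₂
  3≤walk {suc (suc (suc _))} _ _ _ _ = s≤s (s≤s (s≤s z≤n))

  adjacent⇒distance-1 : ∀ {x y} → ¬ x ≈ᵥ y → Adj x y → HasDistance 𝒢 x y 1
  adjacent⇒distance-1 x≉y x~y = step x~y (stop (Setoid.refl vertices)) , λ _ → 1≤walk x≉y

  module _ (_≟_ : Decidable _≈ᵥ_) (adj? : Decidable Adj) where

    -- A distance is a definite least length, so a walk alone does not give one: deciding equality
    -- and then adjacency selects 0, 1 or 2.
    walk-2⇒distance≤2 : ∀ {x y} → Walk 𝒢 2 x y → ∃[ d ] (HasDistance 𝒢 x y d × d ≤ 2)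
    walk-2⇒distance≤2 {x} {y} w with x ≟ y | adj? x y
    ... | yes x≈y | _       = 0 , (stop x≈y , λ _ _ → z≤n) , z≤n
    ... | no x≉y  | yes x~y = 1 , adjacent⇒distance-1 x≉y x~y , s≤s z≤n
    ... | no x≉y  | no x≁y  = 2 , (w , λ _ → 2≤walk x≉y x≁y) , ≤-refl

    -- Meant for vertices on opposite sides, where parity rules out 0 and 2 and only adjacency has
    -- to be decided.
    walk-3⇒distance≤3 : ∀ {x y} → ¬ x ≈ᵥ y → ¬ Walk 𝒢 2 x y → Walk 𝒢 3 x y →
                        ∃[ d ] (HasDistance 𝒢 x y d × d ≤ 3)
    walk-3⇒distance≤3 {x} {y} x≉y ¬w₂ w with adj? x y
    ... | yes x~y = 1 , adjacent⇒distance-1 x≉y x~y , s≤s z≤n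
    ... | no x≁y  = 3 , (w , λ _ → 3≤walk x≉y x≁y ¬w₂) , ≤-refl

-- The group equation behind an edge, and the structure of the bipartite graph.

module _ {c ℓ} (Γ : Group c ℓ) where
  open Group Γ renaming (refl to ≈-refl)
  open GroupProperties Γ
  open SetoidReasoning setoid hiding (stop)

  ≈∙⇒\\≈ : ∀ {u v σ} → u ≈ v ∙ σ → v \\ u ≈ σ
  ≈∙⇒\\≈ {u} {v} {σ} u≈vσ = trans (\\-cong₂ ≈-refl u≈vσ) (\\-leftDividesʳ v σ)

  ≈∙⇒//≈ : ∀ {u v σ} → u ≈ v ∙ σ → u // σ ≈ v
  ≈∙⇒//≈ {u} {v} {σ} u≈vσ = trans (//-cong₂ u≈vσ ≈-refl) (//-rightDividesʳ σ v)

  ≈\\⇒∙≈ : ∀ {u v σ} → σ ≈ v \\ u → v ∙ σ ≈ u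
  ≈\\⇒∙≈ {u} {v} {σ} σ≈ = trans (∙-congˡ σ≈) (\\-leftDividesˡ v u)

  ≈//⇒∙≈ : ∀ {u v σ} → v ≈ u // σ → v ∙ σ ≈ u
  ≈//⇒∙≈ {u} {v} {σ} v≈ = trans (∙-congʳ v≈) (//-rightDividesˡ σ u)

  module _ {p} (S : Pred Carrier p) (S-resp : S Respects _≈_) (m : ℕ) where
    open Graph (G Γ m S) using (Vertex; Adj; _≈ᵥ_)

    adjacent⇒\\∈ : ∀ {i u v} → Adj (suc i , v) (zero , u) → v \\ u ∈ S
    adjacent⇒\\∈ (fwd (edge σ∈S u≈vσ)) = S-resp (sym (≈∙⇒\\≈ u≈vσ)) σ∈S

    \\∈⇒adjacent : ∀ {i u v} → v \\ u ∈ S → Adj (suc i , v) (zero , u)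
    \\∈⇒adjacent {u = u} {v} ∈S = fwd (edge ∈S (sym (\\-leftDividesˡ v u)))

    bipartite : IsBipartite (G Γ m S) (V₀ Γ m) (V₁ Γ m)
    bipartite = record
      { cover        = λ { (zero , _) → inj₁ refl ; (suc i , _) → inj₂ (i , refl) }
      ; disjoint     = λ { refl (_ , ()) }
      ; independentˡ = λ { refl refl (fwd ()) ; refl refl (bwd ()) }
      ; independentʳ = λ { (_ , refl) (_ , refl) (fwd ()) ; (_ , refl) (_ , refl) (bwd ()) }
      }

    -- A neighbour of (0,u) is fixed by a free choice of layer and of σ, through v = uσ⁻¹;
    -- conversely σ = v⁻¹u. This gives the factor m in the degree.
    neighbours₀ : ∀ u → Inverse (×-setoid (≡.setoid (Fin m)) (subsetoid setoid S))
                                (subsetoid (layers Γ m) (Adj (zero , u)))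
    neighbours₀ u = record
      { to        = λ (i , σ , σ∈S) → (suc i , u // σ) , bwd (edge σ∈S (sym (//-rightDividesˡ σ u)))
      ; from      = from
      ; to-cong   = λ { (refl , σ≈) → refl , //-cong₂ ≈-refl σ≈ }
      ; from-cong = λ {x} {y} → from-cong x y
      ; inverse   = (λ {x} {y} → invertˡ x y) , (λ {x} {y} → invertʳ x y)
      }
      where
      N = subsetoid (layers Γ m) (Adj (zero , u))
      M = ×-setoid (≡.setoid (Fin m)) (subsetoid setoid S)
      open Setoid N using () renaming (Carrier to Nbr; _≈_ to _≈ₙ_)
      open Setoid M using () renaming (_≈_ to _≈ₘ_)

      from : Nbr → Setoid.Carrier M
      from ((suc i , v) , bwd e) = i , v \\ u , adjacent⇒\\∈ {i} (fwd e)

      from-cong : ∀ x y → x ≈ₙ y → from x ≈ₘ from y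
      from-cong ((suc i , v) , bwd _) ((suc i , w) , bwd _) (refl , v≈w) = refl , \\-cong₂ v≈w ≈-refl

      invertˡ : ∀ x y → y ≈ₘ from x → (suc (proj₁ y) , u // proj₁ (proj₂ y)) ≈ᵥ proj₁ x
      invertˡ ((suc i , v) , bwd _) _ (refl , σ≈) = refl , ≈∙⇒//≈ (sym (≈\\⇒∙≈ σ≈))

      invertʳ : ∀ x y → proj₁ y ≈ᵥ (suc (proj₁ x) , u // proj₁ (proj₂ x)) → from y ≈ₘ x
      invertʳ _ ((suc i , v) , bwd _) (refl , v≈) = refl , ≈∙⇒\\≈ (sym (≈//⇒∙≈ v≈))

    -- All neighbours (0,vσ) lie in the single layer zero, and left cancellation recovers σ, so they
    -- are counted by `S` alone.
    neighbours₁ : ∀ i v → Inverse (subsetoid setoid S) (subsetoid (layers Γ m) (Adj (suc i , v)))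
    neighbours₁ i v = record
      { to        = λ (σ , σ∈S) → (zero , v ∙ σ) , fwd (edge σ∈S ≈-refl)
      ; from      = λ { ((zero , u) , e) → v \\ u , adjacent⇒\\∈ e ; ((suc _ , _) , bwd ()) }
      ; to-cong   = λ σ≈ → refl , ∙-congˡ σ≈
      ; from-cong = λ { {(zero , _) , fwd _} {(zero , _) , fwd _} (refl , u≈) → \\-cong₂ ≈-refl u≈ }
      ; inverse   = (λ { {(zero , _) , fwd _} σ≈ → refl , ≈\\⇒∙≈ σ≈ })
                  , (λ { {_} {(zero , _) , fwd _} (refl , u≈) → ≈∙⇒\\≈ u≈ })
      }

    -- The label of an edge between (l,v) and (0,u) can only be v⁻¹u, so one membership test settles
    -- adjacency.
    adj? : Unary.Decidable S → Decidable Adj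
    adj? S? (zero  , _) (zero  , _) = no λ { (fwd ()) ; (bwd ()) }
    adj? S? (suc _ , _) (suc _ , _) = no λ { (fwd ()) ; (bwd ()) }
    adj? S? (suc _ , v) (zero  , u) = map′ \\∈⇒adjacent adjacent⇒\\∈ (S? (v \\ u))
    adj? S? (zero  , u) (suc i , v) =
      map′ (λ ∈S → Graph.adj-sym (G Γ m S) (\\∈⇒adjacent ∈S))
           (λ e → adjacent⇒\\∈ (Graph.adj-sym (G Γ m S) {zero , u} {suc i , v} e))
           (S? (v \\ u))

    -- Every edge changes sides, so two steps end on the side where they began.
    ¬walk-2-V₀-V₁ : ∀ {i u v} → ¬ Walk (G Γ m S) 2 (zero , u) (suc i , v)
    ¬walk-2-V₀-V₁ (step (bwd (edge _ _)) (step (fwd (edge _ _)) (stop (() , _))))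

    ¬walk-2-V₁-V₀ : ∀ {i u v} → ¬ Walk (G Γ m S) 2 (suc i , v) (zero , u)
    ¬walk-2-V₁-V₀ (step (fwd (edge _ _)) (step (bwd (edge _ _)) (stop (() , _))))

    -- The middle vertex is (l,uσ⁻¹), in the layer l named by the `Fin m` argument.
    walk-2-V₀ : Fin m → Covering Γ (Inverses Γ S) → ∀ u u′ → Walk (G Γ m S) 2 (zero , u) (zero , u′)
    walk-2-V₀ i covers u u′
      -- With t = σ⁻¹ and t′ = σ′⁻¹, the difference tt′⁻¹ is σ⁻¹σ′.
      with t , t′ , (σ , σ∈S , t≈) , (σ′ , σ′∈S , t′≈) , eq ← covers (u \\ u′)
      = step (bwd (edge {i = i} σ∈S (sym (//-rightDividesˡ σ u))))
          (step (fwd (edge σ′∈S u′≈)) (stop (refl , ≈-refl)))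
      where
      u′≈ : u′ ≈ (u // σ) ∙ σ′
      u′≈ = begin
        u′                     ≈⟨ \\-leftDividesˡ u u′ ⟨
        u ∙ (u \\ u′)          ≈⟨ ∙-congˡ eq ⟩
        u ∙ (t ∙ t′ ⁻¹)        ≈⟨ ∙-congˡ (∙-cong t≈ (⁻¹-cong t′≈)) ⟩
        u ∙ (σ ⁻¹ ∙ σ′ ⁻¹ ⁻¹)  ≈⟨ ∙-congˡ (∙-congˡ (⁻¹-involutive σ′)) ⟩
        u ∙ (σ ⁻¹ ∙ σ′)        ≈⟨ assoc u (σ ⁻¹) σ′ ⟨
        (u // σ) ∙ σ′          ∎

    -- The middle vertex is (0,vσ). It sees every layer, so `i` and `i′` may differ.
    walk-2-V₁ : Covering Γ S → ∀ i v i′ v′ → Walk (G Γ m S) 2 (suc i , v) (suc i′ , v′)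
    walk-2-V₁ covers i v i′ v′ with σ , σ′ , σ∈S , σ′∈S , eq ← covers (v \\ v′)
      = step (fwd (edge σ∈S ≈-refl)) (step (bwd (edge σ′∈S (sym (≈//⇒∙≈ v′≈)))) (stop (refl , ≈-refl)))
      where
      v′≈ : v′ ≈ (v ∙ σ) // σ′
      v′≈ = begin
        v′               ≈⟨ \\-leftDividesˡ v v′ ⟨
        v ∙ (v \\ v′)    ≈⟨ ∙-congˡ eq ⟩
        v ∙ (σ ∙ σ′ ⁻¹)  ≈⟨ assoc v σ (σ′ ⁻¹) ⟨
        (v ∙ σ) // σ′    ∎

    -- Walks between opposite sides, and the diameter.

    module _ (covers : Covering Γ S) (inverses-cover : Covering Γ (Inverses Γ S)) where

      walk-3-V₁-V₀ : ∀ i v u → Walk (G Γ m S) 3 (suc i , v) (zero , u)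
      -- Covering `ε` yields an element of `S`, hence a first edge to the other side.
      walk-3-V₁-V₀ i v u with σ , _ , σ∈S , _ ← covers ε
        = step (fwd (edge σ∈S ≈-refl)) (walk-2-V₀ i inverses-cover (v ∙ σ) u)

      walk-3-V₀-V₁ : ∀ u i v → Walk (G Γ m S) 3 (zero , u) (suc i , v)
      walk-3-V₀-V₁ u i v with σ , _ , σ∈S , _ ← covers ε
        = step (bwd (edge {i = i} σ∈S (sym (//-rightDividesˡ σ u)))) (walk-2-V₁ covers i (u // σ) i v)

      diameter-3 : Fin m → Decidable _≈_ → Unary.Decidable S → ∃[ g ] g ∉ S →
                   HasDiameter (G Γ m S) 3
      diameter-3 i₀ _≟_ S? (g , g∉S) = bounded , (suc i₀ , ε) , (zero , g) , attained
        where
        _≟ᵥ_ : Decidable _≈ᵥ_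
        _≟ᵥ_ = ×-decidable Fin._≟_ _≟_

        distance≤3-if-walk-2 : ∀ {x y} → Walk (G Γ m S) 2 x y →
                               ∃[ d ] (HasDistance (G Γ m S) x y d × d ≤ 3)
        distance≤3-if-walk-2 w
          with d , dist , d≤2 ← walk-2⇒distance≤2 (G Γ m S) _≟ᵥ_ (adj? S?) w
          = d , dist , m≤n⇒m≤1+n d≤2

        bounded : ∀ x y → ∃[ d ] (HasDistance (G Γ m S) x y d × d ≤ 3)
        bounded (zero  , u) (zero   , u′) = distance≤3-if-walk-2 (walk-2-V₀ i₀ inverses-cover u u′)
        bounded (suc i , v) (suc i′ , v′) = distance≤3-if-walk-2 (walk-2-V₁ covers i v i′ v′)
        bounded (suc i , v) (zero   , u)  =
          walk-3⇒distance≤3 (G Γ m S) _≟ᵥ_ (adj? S?) (λ ()) ¬walk-2-V₁-V₀ (walk-3-V₁-V₀ i v u)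
        bounded (zero  , u) (suc i  , v)  =
          walk-3⇒distance≤3 (G Γ m S) _≟ᵥ_ (adj? S?) (λ ()) ¬walk-2-V₀-V₁ (walk-3-V₀-V₁ u i v)

        ε≁g : ¬ Adj (suc i₀ , ε) (zero , g)
        -- An edge here would have label ε⁻¹g, which is `g` itself.
        ε≁g e = g∉S (S-resp (≈∙⇒\\≈ (sym (identityˡ g))) (adjacent⇒\\∈ e))

        attained : HasDistance (G Γ m S) (suc i₀ , ε) (zero , g) 3
        attained = walk-3-V₁-V₀ i₀ ε g , λ _ → 3≤walk (G Γ m S) (λ ()) ε≁g ¬walk-2-V₁-V₀

corollary3p3 : ∀ {c ℓ p} (Γ : Group c ℓ) → NonAbelian Γ →
    (n : ℕ) → HasCardinality (Group.setoid Γ) n →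
    (S : Pred (Group.Carrier Γ) p) → S Respects (Group._≈_ Γ) →
    (s : ℕ) → HasCardinality (subsetoid (Group.setoid Γ) S) s →
    (m : ℕ) → 1 ≤ m →
    IsBipartite (G Γ m S) (V₀ Γ m) (V₁ Γ m)
    × HasCardinality (Graph.vertices (G Γ m S)) ((m + 1) * n)
    × (∀ x → x ∈ V₀ Γ m → HasDegree (G Γ m S) x (m * s))
    × (∀ x → x ∈ V₁ Γ m → HasDegree (G Γ m S) x s)
    × (¬ Universal S → Covering Γ S → Covering Γ (Inverses Γ S) → HasDiameter (G Γ m S) 3)
corollary3p3 Γ _ n card-Γ S S-resp s card-S m@(suc _) _ =
    bipartite Γ S S-resp m
  -- The layers are indexed by `Fin (suc m)`, which gives the factor 1 + m.
  , subst (λ k → HasCardinality (layers Γ m) (k * n)) (+-comm 1 m)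
      (×-cardinality (Identity.inverse _) card-Γ)
  , (λ { (_ , u) refl → Composition.inverse (×-cardinality (Identity.inverse _) card-S)
                                            (neighbours₀ Γ S S-resp m u) })
  , (λ { (_ , v) (i , refl) → Composition.inverse card-S (neighbours₁ Γ S S-resp m i v) })
  , λ ¬all covers inverses-cover →
      -- The index `zero` is the layer l = 1, which exists because m is a successor.
      diameter-3 Γ S S-resp m covers inverses-cover zero _≟_ S? (¬universal⇒∃∉ S-resp card-Γ S? ¬all)
  where
  _≟_ = finite⇒≟ card-Γ
  S?  = finite-subset⇒decidable S-resp _≟_ card-S
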